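{- CNF $\cong$ cps, in the following sense: (1) For all CNF-terms $M$ and values $V$: $(M^{ - })^{+}=M$, $(M^{\wr})^{\times}=M$, $(V^{\sim})^{\times\times}=V$. (2) For all cps-terms $P$, commands $M$ and values $V$: $(P^{+})^{ - }=P$, $(M^{\times})^{\wr}=M$, $(V^{\times\times})^{\sim}=V$. (3) If $M_1\to M_2$ in CNF then $M_1^{\wr}\to M_2^{\wr}$ in cps (hence $M_1^{ - }\to M_2^{ - }$). (4) If $M_1\to M_2$ (commands) in cps then $M_1^{\times}\to M_2^{\times}$ in CNF; hence if $P_1\to P_2$ in cps then $P_1^{+}\to P_2^{+}$ in CNF.
   Context: Terms up to $\alpha$-equivalence; substitution capture-avoiding; one-step reduction is the closure of the rules under all syntactic constructors. CNF: terms $M::=V\mid V(W,x.M)$ ($x$ bound in $M$); values $V,W::=x\mid\lambda x.M$. Left substitution: $[V\backslash x]P=[V/x]P$; $[V(W,y.N)\backslash x]P=V(W,y.[N\backslash x]P)$. Rule $(\beta_v)$ $(\lambda y.M)(W,x.P)\to[[W/y]M\backslash x]P$. cps: a fixed variable $k$. Commands $M::=kV\mid VW(\lambda x.N)$; values $V,W::=x\mid\lambda x.P$; terms $P::=\lambda k.M$. Substitution $[\lambda x.N/k]M$ on commands: $[\lambda x.N/k](kV)=[V/x]N$, $[\lambda x.N/k](VW(\lambda y.M))=VW(\lambda y.[\lambda x.N/k]M)$ (note $k$ does not occur in values). Rule $(\beta_v)$ $(\lambda y.\lambda k.M)W(\lambda x.N)\to[\lambda x.N/k][W/y]M$. Translations: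 $x^{\sim}=x$; $(\lambda x.M)^{\sim}=\lambda x.M^{ - }$; $M^{ - }=\lambda k.M^{\wr}$; $V^{\wr}=kV^{\sim}$; $(V(W,x.M))^{\wr}=V^{\sim}W^{\sim}(\lambda x.M^{\wr})$. Inverse: $x^{\times\times}=x$; $(\lambda x.P)^{\times\times}=\lambda x.P^{+}$; $(\lambda k.M)^{+}=M^{\times}$; $(kV)^{\times}=V^{\times\times}$; $(VW(\lambda x.M))^{\times}=V^{\times\times}(W^{\times\times},x.M^{\times})$. -}

module Defs where

-- Terms are represented with well-scoped de Bruijn indices (Fin n for the
-- variables in scope), so alpha-equivalent terms are syntactically equal
-- and substitution is capture-avoiding by construction.

open import Data.Nat using (ℕ; zero; suc)
open import Data.Fin using (Fin; zero; suc)

mutual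
  data Val (n : ℕ) : Set where
    var : Fin n → Val n
    lam : Tm (suc n) → Val n

  -- terms  M ::= V | V(W, x.M)    (x bound in M)
  data Tm (n : ℕ) : Set where
    val : Val n → Tm n
    app : Val n → Val n → Tm (suc n) → Tm n

ext : ∀ {m n} → (Fin m → Fin n) → Fin (suc m) → Fin (suc n)
ext ρ zero = zero
ext ρ (suc i) = suc (ρ i)

mutual
  renV : ∀ {m n} → (Fin m → Fin n) → Val m → Val n
  renV ρ (var x) = var (ρ x)
  renV ρ (lam M) = lam (renT (ext ρ) M)

  renT : ∀ {m n} → (Fin m → Fin n) → Tm m → Tm n
  renT ρ (val V) = val (renV ρ V)
  renT ρ (app V W M) = app (renV ρ V) (renV ρ W) (renT (ext ρ) M)

exts : ∀ {m n} → (Fin m → Val n) → Fin (suc m) → Val (suc n)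
exts σ zero = var zero
exts σ (suc i) = renV suc (σ i)

mutual
  subV : ∀ {m n} → (Fin m → Val n) → Val m → Val n
  subV σ (var x) = σ x
  subV σ (lam M) = lam (subT (exts σ) M)

  subT : ∀ {m n} → (Fin m → Val n) → Tm m → Tm n
  subT σ (val V) = val (subV σ V)
  subT σ (app V W M) = app (subV σ V) (subV σ W) (subT (exts σ) M)

single : ∀ {n} → Val n → Fin (suc n) → Val n
single W zero = W
single W (suc i) = var i

-- left substitution [M\x]P  (x = index zero of P)
--   [V\x]P = [V/x]P ;  [V(W,y.N)\x]P = V(W, y.[N\x]P)
lsub : ∀ {n} → Tm n → Tm (suc n) → Tm n
lsub (val V) P = subT (single V) P
lsub (app V W N) P = app V W (lsub N (renT (ext suc) P))

mutual
  data _⟶V_ {n : ℕ} : Val n → Val n → Set where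
    ξ-lam : ∀ {M M'} → M ⟶ M' → lam M ⟶V lam M'

  data _⟶_ {n : ℕ} : Tm n → Tm n → Set where
    βv : ∀ {M W P} → app (lam M) W P ⟶ lsub (subT (single W) M) P
    ξ-val : ∀ {V V'} → V ⟶V V' → val V ⟶ val V'
    ξ-app₁ : ∀ {V V' W M} → V ⟶V V' → app V W M ⟶ app V' W M
    ξ-app₂ : ∀ {V W W' M} → W ⟶V W' → app V W M ⟶ app V W' M
    ξ-app₃ : ∀ {V W M M'} → M ⟶ M' → app V W M ⟶ app V W M'

-- cps   (the fixed variable k is implicit: every "kV" refers to the
--        nearest enclosing λk)

mutual
  data CVal (n : ℕ) : Set where
    var : Fin n → CVal n
    lam : CTm (suc n) → CVal n

  data CTm (n : ℕ) : Set where
    lamk : Cmd n → CTm n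

  -- commands  M ::= kV | VW(λx.N)
  data Cmd (n : ℕ) : Set where
    kapp : CVal n → Cmd n
    capp : CVal n → CVal n → Cmd (suc n) → Cmd n

mutual
  crenV : ∀ {m n} → (Fin m → Fin n) → CVal m → CVal n
  crenV ρ (var x) = var (ρ x)
  crenV ρ (lam P) = lam (crenT (ext ρ) P)

  crenT : ∀ {m n} → (Fin m → Fin n) → CTm m → CTm n
  crenT ρ (lamk M) = lamk (crenC ρ M)

  crenC : ∀ {m n} → (Fin m → Fin n) → Cmd m → Cmd n
  crenC ρ (kapp V) = kapp (crenV ρ V)
  crenC ρ (capp V W M) = capp (crenV ρ V) (crenV ρ W) (crenC (ext ρ) M)

cexts : ∀ {m n} → (Fin m → CVal n) → Fin (suc m) → CVal (suc n)
cexts σ zero = var zero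
cexts σ (suc i) = crenV suc (σ i)

mutual
  csubV : ∀ {m n} → (Fin m → CVal n) → CVal m → CVal n
  csubV σ (var x) = σ x
  csubV σ (lam P) = lam (csubT (cexts σ) P)

  csubT : ∀ {m n} → (Fin m → CVal n) → CTm m → CTm n
  csubT σ (lamk M) = lamk (csubC σ M)

  csubC : ∀ {m n} → (Fin m → CVal n) → Cmd m → Cmd n
  csubC σ (kapp V) = kapp (csubV σ V)
  csubC σ (capp V W M) = capp (csubV σ V) (csubV σ W) (csubC (cexts σ) M)

csingle : ∀ {n} → CVal n → Fin (suc n) → CVal n
csingle W zero = W
csingle W (suc i) = var i

-- [λx.N/k]M :  ksub N M
--   [λx.N/k](kV) = [V/x]N ;  [λx.N/k](VW(λy.M)) = VW(λy.[λx.N/k]M)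
ksub : ∀ {n} → Cmd (suc n) → Cmd n → Cmd n
ksub N (kapp V) = csubC (csingle V) N
ksub N (capp V W M) = capp V W (ksub (crenC (ext suc) N) M)

mutual
  data _⟶cV_ {n : ℕ} : CVal n → CVal n → Set where
    ξ-lam : ∀ {P P'} → P ⟶cT P' → lam P ⟶cV lam P'

  data _⟶cT_ {n : ℕ} : CTm n → CTm n → Set where
    ξ-lamk : ∀ {M M'} → M ⟶c M' → lamk M ⟶cT lamk M'

  data _⟶c_ {n : ℕ} : Cmd n → Cmd n → Set where
    βv : ∀ {M W N} → capp (lam (lamk M)) W N ⟶c ksub N (csubC (csingle W) M)
    ξ-kapp : ∀ {V V'} → V ⟶cV V' → kapp V ⟶c kapp V'
    ξ-capp₁ : ∀ {V V' W M} → V ⟶cV V' → capp V W M ⟶c capp V' W M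
    ξ-capp₂ : ∀ {V W W' M} → W ⟶cV W' → capp V W M ⟶c capp V W' M
    ξ-capp₃ : ∀ {V W M M'} → M ⟶c M' → capp V W M ⟶c capp V W M'

mutual
  tilde : ∀ {n} → Val n → CVal n
  tilde (var x) = var x
  tilde (lam M) = lam (minus M)

  minus : ∀ {n} → Tm n → CTm n
  minus M = lamk (wr M)

  wr : ∀ {n} → Tm n → Cmd n
  wr (val V) = kapp (tilde V)
  wr (app V W M) = capp (tilde V) (tilde W) (wr M)

mutual
  timestimes : ∀ {n} → CVal n → Val n
  timestimes (var x) = var x
  timestimes (lam P) = lam (plus P)

  plus : ∀ {n} → CTm n → Tm n
  plus (lamk M) = times M

  times : ∀ {n} → Cmd n → Tm n
  times (kapp V) = val (timestimes V)
  times (capp V W M) = app (timestimes V) (timestimes W) (times M)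

module Submission where

-- Forward simulation rests on the fact that ≀ turns left substitution [M\x]P
-- into continuation substitution [λx.P^≀/k]M^≀; this in turn needs that ~ and
-- ≀ commute with renaming and ordinary substitution. Backward simulation is
-- obtained for free by conjugating these commutation laws with the inverse laws,
-- since the two calculi then have literally corresponding redexes and contracta.

open import Defs
open import Data.Nat using (suc)
open import Data.Fin using (Fin; zero; suc)
open import Data.Product using (_×_; _,_)
open import Relation.Binary.PropositionalEquality
open ≡-Reasoning

cong₃ : ∀ {A B C D : Set} (f : A → B → C → D) {a a′ b b′ c c′} →
        a ≡ a′ → b ≡ b′ → c ≡ c′ → f a b c ≡ f a′ b′ c′
cong₃ f refl refl refl = refl

mutual
  timestimes-tilde : ∀ {n} (V : Val n) → timestimes (tilde V) ≡ V
  timestimes-tilde (var x) = refl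
  timestimes-tilde (lam M) = cong lam (times-wr M)

  times-wr : ∀ {n} (M : Tm n) → times (wr M) ≡ M
  times-wr (val V)     = cong val (timestimes-tilde V)
  times-wr (app V W M) = cong₃ app (timestimes-tilde V) (timestimes-tilde W) (times-wr M)

plus-minus : ∀ {n} (M : Tm n) → plus (minus M) ≡ M
plus-minus = times-wr

mutual
  tilde-timestimes : ∀ {n} (V : CVal n) → tilde (timestimes V) ≡ V
  tilde-timestimes (var x) = refl
  tilde-timestimes (lam P) = cong lam (minus-plus P)

  minus-plus : ∀ {n} (P : CTm n) → minus (plus P) ≡ P
  minus-plus (lamk M) = cong lamk (wr-times M)

  wr-times : ∀ {n} (M : Cmd n) → wr (times M) ≡ M
  wr-times (kapp V)     = cong kapp (tilde-timestimes V)
  wr-times (capp V W M) = cong₃ capp (tilde-timestimes V) (tilde-timestimes W) (wr-times M)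

mutual
  tilde-renV : ∀ {m n} (ρ : Fin m → Fin n) (V : Val m) → tilde (renV ρ V) ≡ crenV ρ (tilde V)
  tilde-renV ρ (var x) = refl
  tilde-renV ρ (lam M) = cong (λ N → lam (lamk N)) (wr-renT (ext ρ) M)

  wr-renT : ∀ {m n} (ρ : Fin m → Fin n) (M : Tm m) → wr (renT ρ M) ≡ crenC ρ (wr M)
  wr-renT ρ (val V)     = cong kapp (tilde-renV ρ V)
  wr-renT ρ (app V W M) = cong₃ capp (tilde-renV ρ V) (tilde-renV ρ W) (wr-renT (ext ρ) M)

tilde-exts : ∀ {m n} {σ : Fin m → Val n} {τ : Fin m → CVal n} →
             (∀ i → tilde (σ i) ≡ τ i) → ∀ i → tilde (exts σ i) ≡ cexts τ i
tilde-exts         σ~τ zero    = refl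
tilde-exts {σ = σ} σ~τ (suc i) = trans (tilde-renV suc (σ i)) (cong (crenV suc) (σ~τ i))

mutual
  tilde-subV : ∀ {m n} {σ : Fin m → Val n} {τ : Fin m → CVal n} →
               (∀ i → tilde (σ i) ≡ τ i) →
               (V : Val m) → tilde (subV σ V) ≡ csubV τ (tilde V)
  tilde-subV σ~τ (var x) = σ~τ x
  tilde-subV σ~τ (lam M) = cong (λ N → lam (lamk N)) (wr-subT (tilde-exts σ~τ) M)

  wr-subT : ∀ {m n} {σ : Fin m → Val n} {τ : Fin m → CVal n} →
            (∀ i → tilde (σ i) ≡ τ i) →
            (M : Tm m) → wr (subT σ M) ≡ csubC τ (wr M)
  wr-subT σ~τ (val V)     = cong kapp (tilde-subV σ~τ V)
  wr-subT σ~τ (app V W M) =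
    cong₃ capp (tilde-subV σ~τ V) (tilde-subV σ~τ W) (wr-subT (tilde-exts σ~τ) M)

tilde-single : ∀ {n} (W : Val n) (i : Fin (suc n)) → tilde (single W i) ≡ csingle (tilde W) i
tilde-single W zero    = refl
tilde-single W (suc i) = refl

wr-subT-single : ∀ {n} (W : Val n) (M : Tm (suc n)) →
                 wr (subT (single W) M) ≡ csubC (csingle (tilde W)) (wr M)
wr-subT-single W = wr-subT (tilde-single W)

wr-lsub : ∀ {n} (M : Tm n) (P : Tm (suc n)) → wr (lsub M P) ≡ ksub (wr P) (wr M)
wr-lsub (val V)     P = wr-subT-single V P
wr-lsub (app V W N) P = cong (capp (tilde V) (tilde W)) (begin
  wr (lsub N (renT (ext suc) P))    ≡⟨ wr-lsub N (renT (ext suc) P) ⟩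
  ksub (wr (renT (ext suc) P)) (wr N) ≡⟨ cong (λ Q → ksub Q (wr N)) (wr-renT (ext suc) P) ⟩
  ksub (crenC (ext suc) (wr P)) (wr N) ∎)

wr-βv-contractum : ∀ {n} (M : Tm (suc n)) (W : Val n) (P : Tm (suc n)) →
                   wr (lsub (subT (single W) M) P)
                   ≡ ksub (wr P) (csubC (csingle (tilde W)) (wr M))
wr-βv-contractum M W P = begin
  wr (lsub (subT (single W) M) P)                 ≡⟨ wr-lsub (subT (single W) M) P ⟩
  ksub (wr P) (wr (subT (single W) M))            ≡⟨ cong (ksub (wr P)) (wr-subT-single W M) ⟩
  ksub (wr P) (csubC (csingle (tilde W)) (wr M))  ∎

times-βv-contractum : ∀ {n} (M : Cmd (suc n)) (W : CVal n) (N : Cmd (suc n)) →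
                      times (ksub N (csubC (csingle W) M))
                      ≡ lsub (subT (single (timestimes W)) (times M)) (times N)
times-βv-contractum M W N = begin
  times (ksub N (csubC (csingle W) M))
    ≡⟨ cong₃ (λ N′ W′ M′ → times (ksub N′ (csubC (csingle W′) M′)))
             (sym (wr-times N)) (sym (tilde-timestimes W)) (sym (wr-times M)) ⟩
  times (ksub (wr N′) (csubC (csingle (tilde W′)) (wr M′)))
    ≡⟨ cong times (sym (wr-βv-contractum M′ W′ N′)) ⟩
  times (wr (lsub (subT (single W′) M′) N′))
    ≡⟨ times-wr _ ⟩
  lsub (subT (single W′) M′) N′ ∎
  where
  M′ = times M
  W′ = timestimes W
  N′ = times N

mutual
  tilde-step : ∀ {n} {V₁ V₂ : Val n} → V₁ ⟶V V₂ → tilde V₁ ⟶cV tilde V₂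
  tilde-step (ξ-lam r) = ξ-lam (minus-step r)

  minus-step : ∀ {n} {M₁ M₂ : Tm n} → M₁ ⟶ M₂ → minus M₁ ⟶cT minus M₂
  minus-step r = ξ-lamk (wr-step r)

  wr-step : ∀ {n} {M₁ M₂ : Tm n} → M₁ ⟶ M₂ → wr M₁ ⟶c wr M₂
  wr-step (βv {M} {W} {P}) = subst (wr (app (lam M) W P) ⟶c_) (sym (wr-βv-contractum M W P)) βv
  wr-step (ξ-val r)  = ξ-kapp (tilde-step r)
  wr-step (ξ-app₁ r) = ξ-capp₁ (tilde-step r)
  wr-step (ξ-app₂ r) = ξ-capp₂ (tilde-step r)
  wr-step (ξ-app₃ r) = ξ-capp₃ (wr-step r)

mutual
  timestimes-step : ∀ {n} {V₁ V₂ : CVal n} → V₁ ⟶cV V₂ → timestimes V₁ ⟶V timestimes V₂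
  timestimes-step (ξ-lam r) = ξ-lam (plus-step r)

  plus-step : ∀ {n} {P₁ P₂ : CTm n} → P₁ ⟶cT P₂ → plus P₁ ⟶ plus P₂
  plus-step (ξ-lamk r) = times-step r

  times-step : ∀ {n} {M₁ M₂ : Cmd n} → M₁ ⟶c M₂ → times M₁ ⟶ times M₂
  times-step (βv {M} {W} {N}) =
    subst (times (capp (lam (lamk M)) W N) ⟶_) (sym (times-βv-contractum M W N)) βv
  times-step (ξ-kapp r)  = ξ-val (timestimes-step r)
  times-step (ξ-capp₁ r) = ξ-app₁ (timestimes-step r)
  times-step (ξ-capp₂ r) = ξ-app₂ (timestimes-step r)
  times-step (ξ-capp₃ r) = ξ-app₃ (times-step r)

theorem5 :
    ((∀ {n} (M : Tm n) → plus (minus M) ≡ M)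
      × (∀ {n} (M : Tm n) → times (wr M) ≡ M)
      × (∀ {n} (V : Val n) → timestimes (tilde V) ≡ V))
  × ((∀ {n} (P : CTm n) → minus (plus P) ≡ P)
      × (∀ {n} (M : Cmd n) → wr (times M) ≡ M)
      × (∀ {n} (V : CVal n) → tilde (timestimes V) ≡ V))
  × ((∀ {n} {M₁ M₂ : Tm n} → M₁ ⟶ M₂ → wr M₁ ⟶c wr M₂)
      × (∀ {n} {M₁ M₂ : Tm n} → M₁ ⟶ M₂ → minus M₁ ⟶cT minus M₂))
  × ((∀ {n} {M₁ M₂ : Cmd n} → M₁ ⟶c M₂ → times M₁ ⟶ times M₂)
      × (∀ {n} {P₁ P₂ : CTm n} → P₁ ⟶cT P₂ → plus P₁ ⟶ plus P₂))
theorem5 =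
    (plus-minus , times-wr , timestimes-tilde)
  , (minus-plus , wr-times , tilde-timestimes)
  , (wr-step , minus-step)
  , (times-step , plus-step)
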